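{- Let $T$ be a plane labelled bipartite tree with $n$ white and $m$ black vertices, where $n+m$ is even. Then the invariant $i(T)$ does not depend on the choice of the white root vertex.
   Context: A plane labelled bipartite tree has white vertices labelled $v_1,\dots,v_n$ and black vertices labelled $u_1,\dots,u_m$ (distinct labels), adjacent vertices having different colours, embedded in the plane. Choose a white root vertex $v_i$ and a root edge $e$ incident to $v_i$. Traverse the boundary of $T$ counterclockwise starting at $v_i$, keeping $e$ to the left; during this walk write the label of a vertex when it is met for the first time, and write a closing bracket ")" when a vertex is met for the last time. This produces a string $c(T)$ of $n+m$ labels and $n+m$ closing brackets. Define: $a$ = number of pairs of white labels $v_k,v_l$ with $v_k$ before $v_l$ in $c(T)$ and $k>l$; $b$ = the analogous number of inversions among black labels $u$; $c$ = number of pairs (black label $u$, white label $v$) with $u$ before $v$ in $c(T)$; $d$ = number of pairs (closing bracket, label) with the bracket before the label in $c(T)$; $e=|n-m|/2$. The invariant is $i(T)\equiv a+b+c+\frac{d+e}{2} \pmod 2$, $i(T)\in\{0,1\}$. (For a fixed root vertex, $i(T)$ is independent of the choice of root edge.) -}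

module Defs where

open import Data.Nat using (ℕ; zero; suc; _+_; _∸_; _<ᵇ_; _/_; _%_)
open import Data.Bool using (Bool; true; false; if_then_else_)
open import Data.List using (List; []; _∷_; _++_; [_]; map; upTo)
open import Data.Product using (_×_)
open import Data.Unit using (⊤)
open import Data.Empty using (⊥)
open import Relation.Binary.PropositionalEquality using (_≡_)
open import Relation.Binary.Construct.Closure.Equivalence using (EqClosure)
open import Data.List.Relation.Binary.Permutation.Propositional using (_↭_)

data Label : Set where
  white : ℕ → Label
  black : ℕ → Label

isWhite : Label → Bool
isWhite (white _) = true
isWhite (black _) = false

-- A plane tree with a distinguished root corner (root vertex + root edge),
-- represented as an ordered rooted tree: the children of a vertex are listed
-- in counterclockwise order starting after the edge to the parent; for the root,
-- the list starts with the root edge e.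
data Tree : Set where
  node : Label → List Tree → Tree

rootLabel : Tree → Label
rootLabel (node x _) = x

data Sym : Set where
  lab   : Label → Sym
  close : Sym

-- c(T): contour walk; label at first visit, ")" at last visit.
mutual
  code : Tree → List Sym
  code (node x ts) = lab x ∷ (codes ts ++ [ close ])

  codes : List Tree → List Sym
  codes [] = []
  codes (t ∷ ts) = code t ++ codes ts

mutual
  labels : Tree → List Label
  labels (node x ts) = x ∷ labelsF ts

  labelsF : List Tree → List Label
  labelsF [] = []
  labelsF (t ∷ ts) = labels t ++ labelsF ts

mutual
  Alternating : Tree → Set
  Alternating (node x ts) = AltChildren x ts

  AltChildren : Label → List Tree → Set
  AltChildren x [] = ⊤
  AltChildren x (t ∷ ts) =
    (isWhite x ≡ isWhite (rootLabel t) → ⊥) × Alternating t × AltChildren x ts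

LabelledBipartite : ℕ → ℕ → Tree → Set
LabelledBipartite n m t =
  Alternating t ×
  (labels t ↭ (map (λ k → white (suc k)) (upTo n) ++ map (λ k → black (suc k)) (upTo m)))

WhiteRoot : Tree → Set
WhiteRoot t = isWhite (rootLabel t) ≡ true

-- Elementary changes of the root corner of the same plane tree:
--  * rotate: change the root edge to the next edge around the root vertex;
--  * move:   move the root to the other end of the root edge.
data RootStep : Tree → Tree → Set where
  rotate : ∀ x c cs → RootStep (node x (c ∷ cs)) (node x (cs ++ [ c ]))
  move   : ∀ x y ds cs → RootStep (node x (node y ds ∷ cs)) (node y (node x cs ∷ ds))

SamePlaneTree : Tree → Tree → Set
SamePlaneTree = EqClosure RootStep

count : (Sym → Bool) → List Sym → ℕ
count p [] = 0
count p (s ∷ ss) = (if p s then 1 else 0) + count p ss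

pairs : (Sym → Sym → Bool) → List Sym → ℕ
pairs P [] = 0
pairs P (s ∷ ss) = count (P s) ss + pairs P ss

whiteInv : Sym → Sym → Bool
whiteInv (lab (white k)) (lab (white l)) = l <ᵇ k
whiteInv _ _ = false

blackInv : Sym → Sym → Bool
blackInv (lab (black k)) (lab (black l)) = l <ᵇ k
blackInv _ _ = false

blackWhite : Sym → Sym → Bool
blackWhite (lab (black _)) (lab (white _)) = true
blackWhite _ _ = false

closeLabel : Sym → Sym → Bool
closeLabel close (lab _) = true
closeLabel _ _ = false

absDiff : ℕ → ℕ → ℕ
absDiff n m = (n ∸ m) + (m ∸ n)

invariant : ℕ → ℕ → Tree → ℕ
invariant n m t =
  (a + b + c + ((d + e) / 2)) % 2
  where
    w = code t
    a = pairs whiteInv w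
    b = pairs blackInv w
    c = pairs blackWhite w
    d = pairs closeLabel w
    e = absDiff n m / 2

{-# OPTIONS --safe #-}
-- Modulo 2, a + b + c is the number of inversions of the word of labels when all
-- white labels are put before all black ones.  Let N = n + m = 2k.  Rotating the
-- root edge preserves d and exchanges two adjacent blocks of labels whose sizes
-- add up to N - 1, so their product is even and the inversion parity is kept.
-- Moving the root along an edge whose two sides have p + 1 and q + 1 vertices,
-- p + q + 2 = N, changes the inversions by 1 + p q ≡ 1 + p and d by p - q, hence
-- (d + e)/2 by k - 1 - p up to sign; altogether the sum changes by k modulo 2.
-- So the sum, corrected by k at black roots, is preserved by every change of the
-- root corner.
module Submission where

open import Defs
open import Data.Bool using (Bool; true; false; if_then_else_)
open import Data.Empty using (⊥-elim)
open import Data.List using (List; []; _∷_; _++_; [_]; length; map; upTo)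
open import Data.List.Properties using (++-assoc; ++-identityʳ; length-++; length-map; length-upTo)
open import Data.List.Relation.Binary.Permutation.Propositional
  using (_↭_; prep; swap; ↭-sym; ↭⇒↭ₛ)
open import Data.List.Relation.Binary.Permutation.Propositional.Properties
  using (++-comm; ↭-length)
import Data.List.Relation.Binary.Permutation.Setoid.Properties as Permutationₛ
open import Data.List.Relation.Unary.All using (All; []; _∷_)
open import Data.List.Relation.Unary.All.Properties using (++⁻)
open import Data.List.Relation.Unary.AllPairs using (_∷_)
open import Data.List.Relation.Unary.Unique.Propositional using (Unique)
import Data.List.Relation.Unary.Unique.Propositional.Properties as Uniqueₚ
open import Data.List.Relation.Binary.Disjoint.Propositional using (Disjoint)
open import Data.List.Membership.Propositional.Properties using (∈-map⁻)
open import Data.Maybe using (just; nothing)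
open import Data.Nat using (ℕ; zero; suc; _+_; _*_; _<ᵇ_; _/_; _%_; parity)
open import Data.Nat.DivMod using (+-distrib-/-∣ˡ; m*n/n≡m)
open import Data.Nat.Divisibility using (_∣_; divides; n∣m*n)
open import Data.Nat.Properties
  using (+-assoc; +-comm; +-identityʳ; *-zeroʳ; +-cancelˡ-≡; ≤-total; m≤n⇒∃[o]m+o≡n; suc-injective)
open import Data.Nat.Tactic.RingSolver renaming (solve-∀ to solveℕ-∀) using ()
open import Data.Parity as ℙ using (Parity; 0ℙ; 1ℙ)
open import Data.Parity.Properties as ℙₚ using (+-homo-+; *-idem)
open import Data.Product using (_×_; _,_; proj₁; proj₂)
open import Data.Sum using (inj₁; inj₂)
open import Data.Unit using (tt)
open import Relation.Binary.Construct.Closure.ReflexiveTransitive using (ε; _◅_)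
open import Relation.Binary.Construct.Closure.Symmetric using (fwd; bwd)
open import Relation.Binary.PropositionalEquality
  using (_≡_; _≢_; refl; sym; trans; cong; cong₂; subst; setoid; module ≡-Reasoning)
open import Tactic.RingSolver using (solve-∀)
open import Tactic.RingSolver.Core.AlmostCommutativeRing
  using (AlmostCommutativeRing; fromCommutativeRing)

open ≡-Reasoning

-- Arithmetic modulo 2

ℙ-ring : AlmostCommutativeRing _ _
-- Recognising `0ℙ` lets the solver drop coefficients such as 1 + 1, so it also proves identities
-- special to characteristic 2.
ℙ-ring = fromCommutativeRing ℙₚ.+-*-commutativeRing λ { 0ℙ → just refl ; 1ℙ → nothing }

parity-suc : ∀ n → parity (suc n) ≡ 1ℙ ℙ.+ parity n
parity-suc n = +-homo-+ 1 n

parity-double : ∀ n → parity (n * 2) ≡ 0ℙ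
parity-double zero    = refl
parity-double (suc n) = parity-double n

parity⇒%2 : ∀ m n → parity m ≡ parity n → m % 2 ≡ n % 2
parity⇒%2 0             0             _  = refl
parity⇒%2 0             1             ()
parity⇒%2 1             0             ()
parity⇒%2 1             1             _  = refl
parity⇒%2 (suc (suc m)) n             eq = parity⇒%2 m n eq
parity⇒%2 0             (suc (suc n)) eq = parity⇒%2 0 n eq
parity⇒%2 1             (suc (suc n)) eq = parity⇒%2 1 n eq

-- Inversions of words of labels

bit : Bool → Parity
bit b = if b then 1ℙ else 0ℙ

-- At most one summand is nonzero: this is the indicator that `y` precedes `x` in the order that
-- puts whites before blacks and compares numbers within a colour.
inverted : Label → Label → Parity
inverted x y =
  (bit (whiteInv (lab x) (lab y)) ℙ.+ bit (blackInv (lab x) (lab y)))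
    ℙ.+ bit (blackWhite (lab x) (lab y))

inversionsWith : Label → List Label → Parity
inversionsWith x []       = 0ℙ
inversionsWith x (y ∷ ys) = inverted x y ℙ.+ inversionsWith x ys

inversions : List Label → Parity
inversions []       = 0ℙ
inversions (x ∷ xs) = inversionsWith x xs ℙ.+ inversions xs

<ᵇ-flip : ∀ k l → k ≢ l → bit (l <ᵇ k) ℙ.+ bit (k <ᵇ l) ≡ 1ℙ
<ᵇ-flip zero    zero    k≢l = ⊥-elim (k≢l refl)
<ᵇ-flip zero    (suc l) k≢l = refl
<ᵇ-flip (suc k) zero    k≢l = refl
<ᵇ-flip (suc k) (suc l) k≢l = <ᵇ-flip k l λ k≡l → k≢l (cong suc k≡l)

-- The order behind `inverted` is total, so exactly one of the two arrangements of distinct labels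
-- is an inversion.
inverted-flip : ∀ {x y} → x ≢ y → inverted x y ℙ.+ inverted y x ≡ 1ℙ
inverted-flip {white k} {white l} x≢y =
  trans (lemma (bit (l <ᵇ k)) (bit (k <ᵇ l))) (<ᵇ-flip k l λ k≡l → x≢y (cong white k≡l))
  where
  lemma : ∀ p q → ((p ℙ.+ 0ℙ) ℙ.+ 0ℙ) ℙ.+ ((q ℙ.+ 0ℙ) ℙ.+ 0ℙ) ≡ p ℙ.+ q
  lemma = solve-∀ ℙ-ring
inverted-flip {white k} {black l} x≢y = refl
inverted-flip {black k} {white l} x≢y = refl
inverted-flip {black k} {black l} x≢y =
  trans (lemma (bit (l <ᵇ k)) (bit (k <ᵇ l))) (<ᵇ-flip k l λ k≡l → x≢y (cong black k≡l))
  where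
  lemma : ∀ p q → (p ℙ.+ 0ℙ) ℙ.+ (q ℙ.+ 0ℙ) ≡ p ℙ.+ q
  lemma = solve-∀ ℙ-ring

inversionsWith-++ : ∀ x ys zs →
  inversionsWith x (ys ++ zs) ≡ inversionsWith x ys ℙ.+ inversionsWith x zs
inversionsWith-++ x []       zs = refl
inversionsWith-++ x (y ∷ ys) zs =
  trans (cong (inverted x y ℙ.+_) (inversionsWith-++ x ys zs))
        (sym (ℙₚ.+-assoc (inverted x y) (inversionsWith x ys) (inversionsWith x zs)))

inversionsWith-++-comm : ∀ x ys zs → inversionsWith x (ys ++ zs) ≡ inversionsWith x (zs ++ ys)
inversionsWith-++-comm x ys zs = begin
  inversionsWith x (ys ++ zs)                     ≡⟨ inversionsWith-++ x ys zs ⟩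
  inversionsWith x ys ℙ.+ inversionsWith x zs     ≡⟨ ℙₚ.+-comm (inversionsWith x ys) _ ⟩
  inversionsWith x zs ℙ.+ inversionsWith x ys     ≡⟨ inversionsWith-++ x zs ys ⟨
  inversionsWith x (zs ++ ys)                     ∎

-- Bringing `x` to the front reverses it with each entry of `ys`, and each reversal contributes 1
-- modulo 2. Pairs with `zs` keep their order.
inversions-shift : ∀ {x} ys zs → All (x ≢_) ys →
  inversions (ys ++ x ∷ zs) ≡ parity (length ys) ℙ.+ inversions (x ∷ ys ++ zs)
inversions-shift         []       zs []           = refl
inversions-shift {x = x} (y ∷ ys) zs (x≢y ∷ x≢ys) = begin
  inversionsWith y (ys ++ x ∷ zs) ℙ.+ inversions (ys ++ x ∷ zs)
    ≡⟨ cong₂ ℙ._+_ (inversionsWith-++ y ys (x ∷ zs)) (inversions-shift ys zs x≢ys) ⟩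
  (Y ℙ.+ (inverted y x ℙ.+ Z)) ℙ.+ (L ℙ.+ (X ℙ.+ I))
    ≡⟨ regroup (inverted x y) (inverted y x) Y Z L X I ⟩
  ((inverted x y ℙ.+ inverted y x) ℙ.+ L) ℙ.+ ((inverted x y ℙ.+ X) ℙ.+ ((Y ℙ.+ Z) ℙ.+ I))
    ≡⟨ cong₂ (λ p q → (p ℙ.+ L) ℙ.+ ((inverted x y ℙ.+ X) ℙ.+ (q ℙ.+ I)))
         (inverted-flip x≢y) (sym (inversionsWith-++ y ys zs)) ⟩
  (1ℙ ℙ.+ L) ℙ.+ inversions (x ∷ y ∷ ys ++ zs)
    ≡⟨ cong (ℙ._+ inversions (x ∷ y ∷ ys ++ zs)) (parity-suc (length ys)) ⟨
  parity (suc (length ys)) ℙ.+ inversions (x ∷ y ∷ ys ++ zs) ∎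
  where
  Y = inversionsWith y ys
  Z = inversionsWith y zs
  L = parity (length ys)
  X = inversionsWith x (ys ++ zs)
  I = inversions (ys ++ zs)
  regroup : ∀ p q Y Z L X I →
    (Y ℙ.+ (q ℙ.+ Z)) ℙ.+ (L ℙ.+ (X ℙ.+ I))
      ≡ ((p ℙ.+ q) ℙ.+ L) ℙ.+ ((p ℙ.+ X) ℙ.+ ((Y ℙ.+ Z) ℙ.+ I))
  regroup = solve-∀ ℙ-ring

-- Exactly the pairs with one label in each block are reversed. The induction brings the labels of
-- `xs` in front of `ys` one at a time.
inversions-++-comm : ∀ xs ys → Unique (xs ++ ys) →
  inversions (ys ++ xs) ≡ (parity (length xs) ℙ.* parity (length ys)) ℙ.+ inversions (xs ++ ys)
inversions-++-comm []       ys _            = cong inversions (++-identityʳ ys)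
inversions-++-comm (x ∷ xs) ys (x≢ ∷ distinct) = begin
  inversions (ys ++ x ∷ xs)
    ≡⟨ inversions-shift ys xs (proj₂ (++⁻ xs x≢)) ⟩
  Q ℙ.+ (inversionsWith x (ys ++ xs) ℙ.+ inversions (ys ++ xs))
    ≡⟨ cong₂ (λ p q → Q ℙ.+ (p ℙ.+ q)) (inversionsWith-++-comm x ys xs)
         (inversions-++-comm xs ys distinct) ⟩
  Q ℙ.+ (X ℙ.+ ((P ℙ.* Q) ℙ.+ I))
    ≡⟨ regroup P Q X I ⟩
  ((1ℙ ℙ.+ P) ℙ.* Q) ℙ.+ (X ℙ.+ I)
    ≡⟨ cong (λ p → (p ℙ.* Q) ℙ.+ (X ℙ.+ I)) (parity-suc (length xs)) ⟨
  (parity (suc (length xs)) ℙ.* Q) ℙ.+ (X ℙ.+ I) ∎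
  where
  P = parity (length xs)
  Q = parity (length ys)
  X = inversionsWith x (xs ++ ys)
  I = inversions (xs ++ ys)
  regroup : ∀ P Q X I → Q ℙ.+ (X ℙ.+ ((P ℙ.* Q) ℙ.+ I)) ≡ ((1ℙ ℙ.+ P) ℙ.* Q) ℙ.+ (X ℙ.+ I)
  regroup = solve-∀ ℙ-ring

-- Serves the change of root edge: `x` stays first and meets the same labels, so only the exchange
-- of the two blocks matters.
inversions-rotate : ∀ x xs ys → Unique (x ∷ xs ++ ys) →
  parity (length xs) ℙ.* parity (length ys) ≡ 0ℙ →
  inversions (x ∷ ys ++ xs) ≡ inversions (x ∷ xs ++ ys)
inversions-rotate x xs ys (_ ∷ distinct) even =
  cong₂ ℙ._+_ (inversionsWith-++-comm x ys xs)
    (trans (inversions-++-comm xs ys distinct) (cong (ℙ._+ inversions (xs ++ ys)) even))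

-- Serves the move of the root along an edge. The 1 comes from reversing `x` and `y`, the product
-- from exchanging the blocks; both ends stay ahead of both blocks.
inversions-exchange : ∀ x y xs ys → Unique (x ∷ y ∷ xs ++ ys) →
  inversions (y ∷ x ∷ ys ++ xs)
    ≡ (1ℙ ℙ.+ (parity (length xs) ℙ.* parity (length ys))) ℙ.+ inversions (x ∷ y ∷ xs ++ ys)
inversions-exchange x y xs ys ((x≢y ∷ _) ∷ _ ∷ distinct) = begin
  (inverted y x ℙ.+ inversionsWith y (ys ++ xs))
    ℙ.+ (inversionsWith x (ys ++ xs) ℙ.+ inversions (ys ++ xs))
    ≡⟨ cong₂ (λ p q → (inverted y x ℙ.+ p) ℙ.+ q) (inversionsWith-++-comm y ys xs)
         (cong₂ ℙ._+_ (inversionsWith-++-comm x ys xs) (inversions-++-comm xs ys distinct)) ⟩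
  (inverted y x ℙ.+ Y) ℙ.+ (X ℙ.+ (PQ ℙ.+ I))
    ≡⟨ regroup (inverted x y) (inverted y x) X Y PQ I ⟩
  ((inverted x y ℙ.+ inverted y x) ℙ.+ PQ) ℙ.+ ((inverted x y ℙ.+ X) ℙ.+ (Y ℙ.+ I))
    ≡⟨ cong (λ p → (p ℙ.+ PQ) ℙ.+ ((inverted x y ℙ.+ X) ℙ.+ (Y ℙ.+ I))) (inverted-flip x≢y) ⟩
  (1ℙ ℙ.+ PQ) ℙ.+ inversions (x ∷ y ∷ xs ++ ys) ∎
  where
  PQ = parity (length xs) ℙ.* parity (length ys)
  X = inversionsWith x (xs ++ ys)
  Y = inversionsWith y (xs ++ ys)
  I = inversions (xs ++ ys)
  regroup : ∀ p q X Y PQ I →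
    (q ℙ.+ Y) ℙ.+ (X ℙ.+ (PQ ℙ.+ I)) ≡ ((p ℙ.+ q) ℙ.+ PQ) ℙ.+ ((p ℙ.+ X) ℙ.+ (Y ℙ.+ I))
  regroup = solve-∀ ℙ-ring

-- Contour words

codes-++ : ∀ ts us → codes (ts ++ us) ≡ codes ts ++ codes us
codes-++ []       us = refl
codes-++ (t ∷ ts) us =
  trans (cong (code t ++_) (codes-++ ts us)) (sym (++-assoc (code t) (codes ts) (codes us)))

labelsF-++ : ∀ ts us → labelsF (ts ++ us) ≡ labelsF ts ++ labelsF us
labelsF-++ []       us = refl
labelsF-++ (t ∷ ts) us =
  trans (cong (labels t ++_) (labelsF-++ ts us))
        (sym (++-assoc (labels t) (labelsF ts) (labelsF us)))

labelsF-snoc : ∀ ts t → labelsF (ts ++ [ t ]) ≡ labelsF ts ++ labels t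
labelsF-snoc ts t =
  trans (labelsF-++ ts [ t ]) (cong (labelsF ts ++_) (++-identityʳ (labels t)))

-- The invariant counts on contour words, while inversions are handled on lists of labels; this
-- projection links the two.
labelsOf : List Sym → List Label
labelsOf []          = []
labelsOf (lab x ∷ w) = x ∷ labelsOf w
labelsOf (close ∷ w) = labelsOf w

labelsOf-++ : ∀ v w → labelsOf (v ++ w) ≡ labelsOf v ++ labelsOf w
labelsOf-++ []          w = refl
labelsOf-++ (lab x ∷ v) w = cong (x ∷_) (labelsOf-++ v w)
labelsOf-++ (close ∷ v) w = labelsOf-++ v w

mutual
  labelsOf-code : ∀ t → labelsOf (code t) ≡ labels t
  labelsOf-code (node x ts) = cong (x ∷_) (begin
    labelsOf (codes ts ++ [ close ]) ≡⟨ labelsOf-++ (codes ts) [ close ] ⟩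
    labelsOf (codes ts) ++ []        ≡⟨ ++-identityʳ _ ⟩
    labelsOf (codes ts)              ≡⟨ labelsOf-codes ts ⟩
    labelsF ts                       ∎)

  labelsOf-codes : ∀ ts → labelsOf (codes ts) ≡ labelsF ts
  labelsOf-codes []       = refl
  labelsOf-codes (t ∷ ts) =
    trans (labelsOf-++ (code t) (codes ts)) (cong₂ _++_ (labelsOf-code t) (labelsOf-codes ts))

closes : List Sym → ℕ
closes []          = 0
closes (lab _ ∷ w) = closes w
closes (close ∷ w) = suc (closes w)

closes-++ : ∀ v w → closes (v ++ w) ≡ closes v + closes w
closes-++ []          w = refl
closes-++ (lab _ ∷ v) w = closes-++ v w
closes-++ (close ∷ v) w = cong suc (closes-++ v w)

mutual
  -- The walk closes every vertex once, so brackets and labels are equally many.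
  closes-code : ∀ t → closes (code t) ≡ length (labels t)
  closes-code (node x ts) = begin
    closes (codes ts ++ [ close ]) ≡⟨ closes-++ (codes ts) [ close ] ⟩
    closes (codes ts) + 1          ≡⟨ +-comm _ 1 ⟩
    suc (closes (codes ts))        ≡⟨ cong suc (closes-codes ts) ⟩
    suc (length (labelsF ts))      ∎

  closes-codes : ∀ ts → closes (codes ts) ≡ length (labelsF ts)
  closes-codes []       = refl
  closes-codes (t ∷ ts) = begin
    closes (code t ++ codes ts)              ≡⟨ closes-++ (code t) (codes ts) ⟩
    closes (code t) + closes (codes ts)      ≡⟨ cong₂ _+_ (closes-code t) (closes-codes ts) ⟩
    length (labels t) + length (labelsF ts)  ≡⟨ length-++ (labels t) ⟨
    length (labels t ++ labelsF ts)          ∎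

-- Pairs of a bracket before a label

count-none : ∀ {p} → (∀ s → p s ≡ false) → ∀ w → count p w ≡ 0
count-none none []      = refl
count-none none (s ∷ w) rewrite none s = count-none none w

count-closeLabel : ∀ w → count (closeLabel close) w ≡ length (labelsOf w)
count-closeLabel []          = refl
count-closeLabel (lab _ ∷ w) = cong suc (count-closeLabel w)
count-closeLabel (close ∷ w) = count-closeLabel w

-- The product collects the cross pairs: every bracket of `v` comes before every label of `w`.
pairs-closeLabel-++ : ∀ v w →
  pairs closeLabel (v ++ w)
    ≡ (pairs closeLabel v + pairs closeLabel w) + closes v * length (labelsOf w)
pairs-closeLabel-++ []          w = sym (+-identityʳ _)
pairs-closeLabel-++ (lab x ∷ v) w = begin
  count (closeLabel (lab x)) (v ++ w) + pairs closeLabel (v ++ w)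
    ≡⟨ cong (_+ pairs closeLabel (v ++ w)) (count-none (λ _ → refl) (v ++ w)) ⟩
  pairs closeLabel (v ++ w)
    ≡⟨ pairs-closeLabel-++ v w ⟩
  (pairs closeLabel v + pairs closeLabel w) + closes v * length (labelsOf w)
    ≡⟨ cong (λ k → ((k + pairs closeLabel v) + pairs closeLabel w) + closes v * length (labelsOf w))
         (count-none (λ _ → refl) v) ⟨
  (pairs closeLabel (lab x ∷ v) + pairs closeLabel w) + closes v * length (labelsOf w) ∎
pairs-closeLabel-++ (close ∷ v) w = begin
  count (closeLabel close) (v ++ w) + pairs closeLabel (v ++ w)
    ≡⟨ cong₂ _+_ (trans (count-closeLabel (v ++ w))
                   (trans (cong length (labelsOf-++ v w)) (length-++ (labelsOf v))))
         (pairs-closeLabel-++ v w) ⟩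
  (length (labelsOf v) + B) + ((P + Q) + closes v * B)
    ≡⟨ cong (λ k → (k + B) + ((P + Q) + closes v * B)) (count-closeLabel v) ⟨
  (count (closeLabel close) v + B) + ((P + Q) + closes v * B)
    ≡⟨ regroup (count (closeLabel close) v) B P Q (closes v) ⟩
  ((count (closeLabel close) v + P) + Q) + suc (closes v) * B ∎
  where
  B = length (labelsOf w)
  P = pairs closeLabel v
  Q = pairs closeLabel w
  regroup : ∀ A B P Q c → (A + B) + ((P + Q) + c * B) ≡ ((A + P) + Q) + suc c * B
  regroup = solveℕ-∀

closeLabels : Tree → ℕ
closeLabels t = pairs closeLabel (code t)

closeLabelsF : List Tree → ℕ
closeLabelsF ts = pairs closeLabel (codes ts)

-- The label of the root precedes all brackets and its bracket follows all labels, so neither takes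
-- part in a counted pair.
closeLabels-node : ∀ x ts → closeLabels (node x ts) ≡ closeLabelsF ts
closeLabels-node x ts = begin
  count (closeLabel (lab x)) (codes ts ++ [ close ]) + pairs closeLabel (codes ts ++ [ close ])
    ≡⟨ cong (_+ pairs closeLabel (codes ts ++ [ close ])) (count-none (λ _ → refl) (codes ts ++ [ close ])) ⟩
  pairs closeLabel (codes ts ++ [ close ])
    ≡⟨ pairs-closeLabel-++ (codes ts) [ close ] ⟩
  (closeLabelsF ts + 0) + closes (codes ts) * 0
    ≡⟨ cong₂ _+_ (+-identityʳ _) (*-zeroʳ (closes (codes ts))) ⟩
  closeLabelsF ts + 0
    ≡⟨ +-identityʳ _ ⟩
  closeLabelsF ts ∎

closeLabelsF-++ : ∀ ts us →
  closeLabelsF (ts ++ us)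
    ≡ (closeLabelsF ts + closeLabelsF us) + length (labelsF ts) * length (labelsF us)
closeLabelsF-++ ts us = begin
  pairs closeLabel (codes (ts ++ us))
    ≡⟨ cong (pairs closeLabel) (codes-++ ts us) ⟩
  pairs closeLabel (codes ts ++ codes us)
    ≡⟨ pairs-closeLabel-++ (codes ts) (codes us) ⟩
  (closeLabelsF ts + closeLabelsF us) + closes (codes ts) * length (labelsOf (codes us))
    ≡⟨ cong₂ (λ k ls → (closeLabelsF ts + closeLabelsF us) + k * length ls)
         (closes-codes ts) (labelsOf-codes us) ⟩
  (closeLabelsF ts + closeLabelsF us) + length (labelsF ts) * length (labelsF us) ∎

-- The cross term between two parts of the list of children is symmetric in the parts.
closeLabels-rotate : ∀ x ts us → closeLabels (node x (us ++ ts)) ≡ closeLabels (node x (ts ++ us))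
closeLabels-rotate x ts us = begin
  closeLabels (node x (us ++ ts)) ≡⟨ closeLabels-node x (us ++ ts) ⟩
  closeLabelsF (us ++ ts)         ≡⟨ closeLabelsF-++ us ts ⟩
  (closeLabelsF us + closeLabelsF ts) + length (labelsF us) * length (labelsF ts)
    ≡⟨ regroup (closeLabelsF us) (closeLabelsF ts) (length (labelsF us)) (length (labelsF ts)) ⟩
  (closeLabelsF ts + closeLabelsF us) + length (labelsF ts) * length (labelsF us)
    ≡⟨ closeLabelsF-++ ts us ⟨
  closeLabelsF (ts ++ us)         ≡⟨ closeLabels-node x (ts ++ us) ⟨
  closeLabels (node x (ts ++ us)) ∎
  where
  regroup : ∀ a b c d → (a + b) + c * d ≡ (b + a) + d * c
  regroup = solveℕ-∀

-- The subtree at `y` puts one bracket per vertex, `y` included, before every label of `cs`; hence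
-- the `suc`.
closeLabels-edge : ∀ x y ds cs →
  closeLabels (node x (node y ds ∷ cs))
    ≡ (closeLabelsF ds + closeLabelsF cs) + suc (length (labelsF ds)) * length (labelsF cs)
closeLabels-edge x y ds cs = begin
  closeLabels (node x (node y ds ∷ cs))
    ≡⟨ closeLabels-node x (node y ds ∷ cs) ⟩
  closeLabelsF (node y ds ∷ cs)
    ≡⟨ closeLabelsF-++ [ node y ds ] cs ⟩
  (closeLabelsF [ node y ds ] + closeLabelsF cs)
    + length (labelsF [ node y ds ]) * length (labelsF cs)
    ≡⟨ cong₂ (λ w ls → (pairs closeLabel w + closeLabelsF cs) + length ls * length (labelsF cs))
         (++-identityʳ (code (node y ds))) (++-identityʳ (labels (node y ds))) ⟩
  (closeLabels (node y ds) + closeLabelsF cs) + suc (length (labelsF ds)) * length (labelsF cs)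
    ≡⟨ cong (λ k → (k + closeLabelsF cs) + suc (length (labelsF ds)) * length (labelsF cs))
         (closeLabels-node y ds) ⟩
  (closeLabelsF ds + closeLabelsF cs) + suc (length (labelsF ds)) * length (labelsF cs) ∎

-- Besides the pairs inside `ds` and inside `cs`, both sides amount to `p * q + p + q`. Adding on
-- both sides avoids truncated subtraction.
closeLabels-move : ∀ x y ds cs →
  closeLabels (node x (node y ds ∷ cs)) + length (labelsF ds)
    ≡ closeLabels (node y (node x cs ∷ ds)) + length (labelsF cs)
closeLabels-move x y ds cs = begin
  closeLabels (node x (node y ds ∷ cs)) + p ≡⟨ cong (_+ p) (closeLabels-edge x y ds cs) ⟩
  ((D + C) + suc p * q) + p                 ≡⟨ regroup D C p q ⟩
  ((C + D) + suc q * p) + q                 ≡⟨ cong (_+ q) (closeLabels-edge y x cs ds) ⟨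
  closeLabels (node y (node x cs ∷ ds)) + q ∎
  where
  D = closeLabelsF ds
  C = closeLabelsF cs
  p = length (labelsF ds)
  q = length (labelsF cs)
  regroup : ∀ D C p q → ((D + C) + suc p * q) + p ≡ ((C + D) + suc q * p) + q
  regroup = solveℕ-∀

-- Parity of the inversion counts

inversionCount : List Sym → ℕ
inversionCount w = pairs whiteInv w + pairs blackInv w + pairs blackWhite w

parity-indicator : ∀ b n → parity ((if b then 1 else 0) + n) ≡ bit b ℙ.+ parity n
parity-indicator true  n = parity-suc n
parity-indicator false n = refl

parity-+₃ : ∀ k l m → parity (k + l + m) ≡ (parity k ℙ.+ parity l) ℙ.+ parity m
parity-+₃ k l m = trans (+-homo-+ (k + l) m) (cong (ℙ._+ parity m) (+-homo-+ k l))

-- The defining clauses inspect the colour first, so the catch-all clause fires only after a case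
-- split on `x`.
whiteInv-close : ∀ x → whiteInv (lab x) close ≡ false
whiteInv-close (white _) = refl
whiteInv-close (black _) = refl

blackInv-close : ∀ x → blackInv (lab x) close ≡ false
blackInv-close (white _) = refl
blackInv-close (black _) = refl

blackWhite-close : ∀ x → blackWhite (lab x) close ≡ false
blackWhite-close (white _) = refl
blackWhite-close (black _) = refl

parity-count : ∀ x w →
  (parity (count (whiteInv (lab x)) w) ℙ.+ parity (count (blackInv (lab x)) w))
    ℙ.+ parity (count (blackWhite (lab x)) w)
    ≡ inversionsWith x (labelsOf w)
parity-count x []          = refl
parity-count x (close ∷ w)
  rewrite whiteInv-close x | blackInv-close x | blackWhite-close x = parity-count x w
parity-count x (lab y ∷ w) = begin
  (parity ((if i then 1 else 0) + k) ℙ.+ parity ((if j then 1 else 0) + l))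
    ℙ.+ parity ((if h then 1 else 0) + m)
    ≡⟨ cong₂ ℙ._+_ (cong₂ ℙ._+_ (parity-indicator i k) (parity-indicator j l))
         (parity-indicator h m) ⟩
  ((bit i ℙ.+ parity k) ℙ.+ (bit j ℙ.+ parity l)) ℙ.+ (bit h ℙ.+ parity m)
    ≡⟨ regroup (bit i) (bit j) (bit h) (parity k) (parity l) (parity m) ⟩
  inverted x y ℙ.+ ((parity k ℙ.+ parity l) ℙ.+ parity m)
    ≡⟨ cong (inverted x y ℙ.+_) (parity-count x w) ⟩
  inverted x y ℙ.+ inversionsWith x (labelsOf w) ∎
  where
  i = whiteInv (lab x) (lab y)
  j = blackInv (lab x) (lab y)
  h = blackWhite (lab x) (lab y)
  k = count (whiteInv (lab x)) w
  l = count (blackInv (lab x)) w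
  m = count (blackWhite (lab x)) w
  regroup : ∀ i j h k l m →
    ((i ℙ.+ k) ℙ.+ (j ℙ.+ l)) ℙ.+ (h ℙ.+ m) ≡ ((i ℙ.+ j) ℙ.+ h) ℙ.+ ((k ℙ.+ l) ℙ.+ m)
  regroup = solve-∀ ℙ-ring

parity-inversionCount : ∀ w → parity (inversionCount w) ≡ inversions (labelsOf w)
parity-inversionCount []          = refl
parity-inversionCount (close ∷ w)
  -- Applied to `close`, all three predicates are the constant `false` up to eta, so this one
  -- rewrite clears all three counts.
  rewrite count-none {λ _ → false} (λ _ → refl) w = parity-inversionCount w
parity-inversionCount (lab x ∷ w) = begin
  parity ((i + k) + (j + l) + (h + m))
    ≡⟨ cong parity (regroup i j h k l m) ⟩
  parity ((i + j + h) + (k + l + m))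
    ≡⟨ +-homo-+ (i + j + h) (k + l + m) ⟩
  parity (i + j + h) ℙ.+ parity (k + l + m)
    ≡⟨ cong₂ ℙ._+_ (trans (parity-+₃ i j h) (parity-count x w)) (parity-inversionCount w) ⟩
  inversionsWith x (labelsOf w) ℙ.+ inversions (labelsOf w) ∎
  where
  i = count (whiteInv (lab x)) w
  j = count (blackInv (lab x)) w
  h = count (blackWhite (lab x)) w
  k = pairs whiteInv w
  l = pairs blackInv w
  m = pairs blackWhite w
  regroup : ∀ i j h k l m → (i + k) + (j + l) + (h + m) ≡ (i + j + h) + (k + l + m)
  regroup = solveℕ-∀

-- Effect of root changes

parity-sum≡0⇒≡ : ∀ p q → p ℙ.+ q ≡ 0ℙ → p ≡ q
parity-sum≡0⇒≡ 0ℙ 0ℙ _ = refl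
parity-sum≡0⇒≡ 1ℙ 1ℙ _ = refl

-- Division truncates, but an even summand splits off exactly, whatever the parity of the rest.
half-shift : ∀ j n → parity ((j * 2 + n) / 2) ≡ parity j ℙ.+ parity (n / 2)
half-shift j n = begin
  parity ((j * 2 + n) / 2)       ≡⟨ cong parity (+-distrib-/-∣ˡ n (n∣m*n j {2})) ⟩
  parity (j * 2 / 2 + n / 2)     ≡⟨ cong (λ i → parity (i + n / 2)) (m*n/n≡m j 2) ⟩
  parity (j + n / 2)             ≡⟨ +-homo-+ j (n / 2) ⟩
  parity j ℙ.+ parity (n / 2)    ∎

-- Here `q` is `p + j * 2`, so the balance gives `d ≡ d′ + j * 2`. The halves then differ by `j`,
-- which agrees with `p + k` modulo 2. The witness `j` expresses the case `p ≤ k`.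
half-balance-offset : ∀ e k p q d d′ j → p + j ≡ k → d + p ≡ d′ + q → p + q ≡ k * 2 →
  parity ((d + e) / 2) ≡ parity ((d′ + e) / 2) ℙ.+ (parity p ℙ.+ parity k)
half-balance-offset e k p q d d′ j refl balance size = begin
  parity ((d + e) / 2)             ≡⟨ cong (λ i → parity ((i + e) / 2)) d≡ ⟩
  parity ((j * 2 + d′ + e) / 2)    ≡⟨ cong (λ i → parity (i / 2)) (+-assoc (j * 2) d′ e) ⟩
  parity ((j * 2 + (d′ + e)) / 2)  ≡⟨ half-shift j (d′ + e) ⟩
  -- Adding `parity p` twice changes nothing and makes `p + j`, that is `k`, appear.
  parity j ℙ.+ H                   ≡⟨ regroup (parity p) (parity j) H ⟩
  H ℙ.+ (parity p ℙ.+ (parity p ℙ.+ parity j))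
    ≡⟨ cong (λ r → H ℙ.+ (parity p ℙ.+ r)) (+-homo-+ p j) ⟨
  H ℙ.+ (parity p ℙ.+ parity (p + j)) ∎
  where
  H = parity ((d′ + e) / 2)
  double : ∀ p j → (p + j) * 2 ≡ p + (p + j * 2)
  double = solveℕ-∀
  q≡ : q ≡ p + j * 2
  q≡ = +-cancelˡ-≡ p q (p + j * 2) (trans size (double p j))
  rearrange : ∀ d′ p i → d′ + (p + i) ≡ p + (i + d′)
  rearrange = solveℕ-∀
  d≡ : d ≡ j * 2 + d′
  d≡ = +-cancelˡ-≡ p d (j * 2 + d′) (begin
    p + d            ≡⟨ +-comm p d ⟩
    d + p            ≡⟨ balance ⟩
    d′ + q           ≡⟨ cong (d′ +_) q≡ ⟩
    d′ + (p + j * 2) ≡⟨ rearrange d′ p (j * 2) ⟩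
    p + (j * 2 + d′) ∎)
  regroup : ∀ p j h → j ℙ.+ h ≡ h ℙ.+ (p ℙ.+ (p ℙ.+ j))
  regroup = solve-∀ ℙ-ring

parity-halves : ∀ k p q → p + q ≡ k * 2 → parity p ≡ parity q
parity-halves k p q size =
  parity-sum≡0⇒≡ (parity p) (parity q)
    (trans (sym (+-homo-+ p q)) (trans (cong parity size) (parity-double k)))

-- If `p ≤ k`, the relation of `half-balance-offset` is solved for the other half by adding the same
-- parity again. If `k ≤ p`, then `q ≤ k` and it applies with the two trees exchanged, since `p` and
-- `q` have equal parity.
half-balance : ∀ e k p q d d′ → d + p ≡ d′ + q → p + q ≡ k * 2 →
  parity ((d′ + e) / 2) ≡ parity ((d + e) / 2) ℙ.+ (parity p ℙ.+ parity k)
half-balance e k p q d d′ balance size with ≤-total p k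
... | inj₁ p≤k with j , p+j≡k ← m≤n⇒∃[o]m+o≡n p≤k = begin
  H′                       ≡⟨ cancel H′ (parity p ℙ.+ parity k) ⟩
  (H′ ℙ.+ PK) ℙ.+ PK       ≡⟨ cong (ℙ._+ PK) (half-balance-offset e k p q d d′ j p+j≡k balance size) ⟨
  parity ((d + e) / 2) ℙ.+ PK ∎
  where
  H′ = parity ((d′ + e) / 2)
  PK = parity p ℙ.+ parity k
  cancel : ∀ h r → h ≡ (h ℙ.+ r) ℙ.+ r
  cancel = solve-∀ ℙ-ring
... | inj₂ k≤p with j , k+j≡p ← m≤n⇒∃[o]m+o≡n k≤p = begin
  parity ((d′ + e) / 2)
    ≡⟨ half-balance-offset e k q p d′ d j q+j≡k (sym balance) (trans (+-comm q p) size) ⟩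
  parity ((d + e) / 2) ℙ.+ (parity q ℙ.+ parity k)
    ≡⟨ cong (λ r → parity ((d + e) / 2) ℙ.+ (r ℙ.+ parity k)) (parity-halves k p q size) ⟨
  parity ((d + e) / 2) ℙ.+ (parity p ℙ.+ parity k) ∎
  where
  rearrange : ∀ k q j → k + (q + j) ≡ (k + j) + q
  rearrange = solveℕ-∀
  double : ∀ k → k * 2 ≡ k + k
  double = solveℕ-∀
  q+j≡k : q + j ≡ k
  q+j≡k = +-cancelˡ-≡ k (q + j) k (begin
    k + (q + j) ≡⟨ rearrange k q j ⟩
    (k + j) + q ≡⟨ cong (_+ q) k+j≡p ⟩
    p + q       ≡⟨ size ⟩
    k * 2       ≡⟨ double k ⟩
    k + k       ∎)

-- The sum corrected at black roots

rootTerm : ℕ → Label → Parity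
rootTerm k x = if isWhite x then 0ℙ else parity k

-- Changing colour toggles the correction: on leaving a black root, `parity k` occurs twice and
-- cancels.
rootTerm-opposite : ∀ k x y → isWhite x ≢ isWhite y → rootTerm k y ≡ rootTerm k x ℙ.+ parity k
rootTerm-opposite k (white _) (white _) x≢y = ⊥-elim (x≢y refl)
rootTerm-opposite k (white _) (black _) x≢y = refl
rootTerm-opposite k (black _) (white _) x≢y = sym (ℙₚ.p+p≡0ℙ (parity k))
rootTerm-opposite k (black _) (black _) x≢y = ⊥-elim (x≢y refl)

-- A path between white roots passes through black ones, where the bare sum is off by `k` modulo 2;
-- the last term compensates.
potential : ℕ → ℕ → Tree → Parity
potential e k t =
  (inversions (labels t) ℙ.+ parity ((closeLabels t + e) / 2)) ℙ.+ rootTerm k (rootLabel t)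

-- What a root step consumes and reproduces: distinctness makes each reversed pair count, the size
-- controls the parities of the blocks, and alternation makes a move change the colour of the root.
record WellFormed (k : ℕ) (t : Tree) : Set where
  field
    alternating : Alternating t
    distinct    : Unique (labels t)
    size        : length (labels t) ≡ k * 2

open WellFormed

AltChildren-++⁺ : ∀ {x} ts {us} → AltChildren x ts → AltChildren x us → AltChildren x (ts ++ us)
AltChildren-++⁺ []       _                 alt-us = alt-us
AltChildren-++⁺ (t ∷ ts) (x≢t , alt , alts) alt-us = x≢t , alt , AltChildren-++⁺ ts alts alt-us

AltChildren-++⁻ : ∀ {x} ts {us} → AltChildren x (ts ++ us) → AltChildren x ts × AltChildren x us
AltChildren-++⁻ []       alt-us             = tt , alt-us
AltChildren-++⁻ (t ∷ ts) (x≢t , alt , alts) with alt-ts , alt-us ← AltChildren-++⁻ ts alts =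
  (x≢t , alt , alt-ts) , alt-us

-- Stated for any cut of the children, so that a rotation and its reverse are both instances.
AltChildren-rotate : ∀ {x} ts us → AltChildren x (ts ++ us) → AltChildren x (us ++ ts)
AltChildren-rotate ts us alt with alt-ts , alt-us ← AltChildren-++⁻ ts alt =
  AltChildren-++⁺ us alt-us alt-ts

Alternating-move : ∀ x y ds cs →
  Alternating (node x (node y ds ∷ cs)) → Alternating (node y (node x cs ∷ ds))
Alternating-move x y ds cs (x≢y , alt-ds , alt-cs) = (λ eq → x≢y (sym eq)) , alt-cs , alt-ds

labels-step : ∀ {t t′} → RootStep t t′ → labels t ↭ labels t′
labels-step (rotate x c cs) = prep x
  (subst (labels c ++ labelsF cs ↭_) (sym (labelsF-snoc cs c)) (++-comm (labels c) (labelsF cs)))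
labels-step (move x y ds cs) = swap x y (++-comm (labelsF ds) (labelsF cs))

WellFormed-resp : ∀ {k t t′} → labels t ↭ labels t′ → Alternating t′ →
  WellFormed k t → WellFormed k t′
WellFormed-resp t↭t′ alt′ wf = record
  { alternating = alt′
  ; distinct    = Permutationₛ.Unique-resp-↭ (setoid Label) (↭⇒↭ₛ t↭t′) (distinct wf)
  ; size        = trans (sym (↭-length t↭t′)) (size wf)
  }

WellFormed-step : ∀ {k t t′} → RootStep t t′ → WellFormed k t → WellFormed k t′
WellFormed-step s@(rotate x c cs) wf =
  WellFormed-resp (labels-step s) (AltChildren-rotate [ c ] cs (alternating wf)) wf
WellFormed-step s@(move x y ds cs) wf =
  WellFormed-resp (labels-step s) (Alternating-move x y ds cs (alternating wf)) wf

WellFormed-unstep : ∀ {k t t′} → RootStep t t′ → WellFormed k t′ → WellFormed k t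
WellFormed-unstep s@(rotate x c cs) wf =
  WellFormed-resp (↭-sym (labels-step s)) (AltChildren-rotate cs [ c ] (alternating wf)) wf
-- A move is undone by the move with the two ends and their remaining children exchanged.
WellFormed-unstep (move x y ds cs) wf = WellFormed-step (move y x cs ds) wf

-- Invariance of the corrected sum

even-product : ∀ k p q → suc (p + q) ≡ k * 2 → parity p ℙ.* parity q ≡ 0ℙ
-- With the root set aside, `p + q` is odd, so one of the two is even.
even-product k p q size = lemma (parity p) (parity q) (begin
  1ℙ ℙ.+ (parity p ℙ.+ parity q) ≡⟨ cong (1ℙ ℙ.+_) (+-homo-+ p q) ⟨
  1ℙ ℙ.+ parity (p + q)          ≡⟨ parity-suc (p + q) ⟨
  parity (suc (p + q))           ≡⟨ cong parity size ⟩
  parity (k * 2)                 ≡⟨ parity-double k ⟩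
  0ℙ                             ∎)
  where
  lemma : ∀ p q → 1ℙ ℙ.+ (p ℙ.+ q) ≡ 0ℙ → p ℙ.* q ≡ 0ℙ
  lemma 0ℙ q  _ = refl
  lemma 1ℙ 0ℙ _ = refl

potential-step : ∀ e {k t t′} → RootStep t t′ → WellFormed k t → potential e k t′ ≡ potential e k t
potential-step e {k} (rotate x c cs) wf =
  cong₂ (λ i d → (i ℙ.+ parity ((d + e) / 2)) ℙ.+ rootTerm k x) inversions≡
    (closeLabels-rotate x [ c ] cs)
  where
  inversions≡ : inversions (x ∷ labelsF (cs ++ [ c ])) ≡ inversions (x ∷ labels c ++ labelsF cs)
  inversions≡ = begin
    inversions (x ∷ labelsF (cs ++ [ c ]))
      ≡⟨ cong (λ ls → inversions (x ∷ ls)) (labelsF-snoc cs c) ⟩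
    inversions (x ∷ labelsF cs ++ labels c)
      ≡⟨ inversions-rotate x (labels c) (labelsF cs) (distinct wf)
           (even-product k (length (labels c)) (length (labelsF cs))
             (trans (cong suc (sym (length-++ (labels c)))) (size wf))) ⟩
    inversions (x ∷ labels c ++ labelsF cs) ∎
-- The two ends of the edge are already two vertices, so the half size is a successor. The blocks
-- `ds` and `cs` share the remaining `k * 2` vertices, and `half-balance` is used with this smaller
-- `k`.
potential-step e {suc k} (move x y ds cs) wf = begin
  (inversions (y ∷ x ∷ labelsF cs ++ labelsF ds) ℙ.+ parity ((d′ + e) / 2)) ℙ.+ rootTerm (suc k) y
    ≡⟨ cong₂ ℙ._+_
         (cong₂ ℙ._+_ (inversions-exchange x y (labelsF ds) (labelsF cs) (distinct wf))
           (half-balance e k p q d d′ (closeLabels-move x y ds cs) size′))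
         (trans (rootTerm-opposite (suc k) x y (proj₁ (alternating wf))) (cong (R ℙ.+_) (parity-suc k))) ⟩
  (((1ℙ ℙ.+ (P ℙ.* parity q)) ℙ.+ I) ℙ.+ (H ℙ.+ (P ℙ.+ K))) ℙ.+ (R ℙ.+ (1ℙ ℙ.+ K))
    -- As `p + q` is even, `p` and `q` agree modulo 2, and the product of their parities is a
    -- square, hence `P` itself.
    ≡⟨ cong (λ r → (((1ℙ ℙ.+ r) ℙ.+ I) ℙ.+ (H ℙ.+ (P ℙ.+ K))) ℙ.+ (R ℙ.+ (1ℙ ℙ.+ K)))
         (trans (cong (P ℙ.*_) (sym (parity-halves k p q size′))) (*-idem P)) ⟩
  (((1ℙ ℙ.+ P) ℙ.+ I) ℙ.+ (H ℙ.+ (P ℙ.+ K))) ℙ.+ (R ℙ.+ (1ℙ ℙ.+ K))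
    -- Each of `1ℙ`, `P` and `K` occurs twice: the changes of the inversions, of the halved bracket
    -- count and of the correction add up to zero.
    ≡⟨ cancel P I H K R ⟩
  (I ℙ.+ H) ℙ.+ R ∎
  where
  p = length (labelsF ds)
  q = length (labelsF cs)
  d = closeLabels (node x (node y ds ∷ cs))
  d′ = closeLabels (node y (node x cs ∷ ds))
  P = parity p
  K = parity k
  I = inversions (x ∷ y ∷ labelsF ds ++ labelsF cs)
  H = parity ((d + e) / 2)
  R = rootTerm (suc k) x
  size′ : p + q ≡ k * 2
  size′ = trans (sym (length-++ (labelsF ds))) (suc-injective (suc-injective (size wf)))
  cancel : ∀ P I H K R →
    (((1ℙ ℙ.+ P) ℙ.+ I) ℙ.+ (H ℙ.+ (P ℙ.+ K))) ℙ.+ (R ℙ.+ (1ℙ ℙ.+ K)) ≡ (I ℙ.+ H) ℙ.+ R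
  cancel = solve-∀ ℙ-ring

potential-invariant : ∀ e {k t t′} → SamePlaneTree t t′ → WellFormed k t →
  potential e k t ≡ potential e k t′
potential-invariant e ε            wf = refl
potential-invariant e (fwd s ◅ ss) wf =
  trans (sym (potential-step e s wf)) (potential-invariant e ss (WellFormed-step s wf))
-- The source of a backward step is the next tree of the path, so well-formedness is first carried
-- over to it.
potential-invariant e (bwd s ◅ ss) wf =
  trans (potential-step e s (WellFormed-unstep s wf))
        (potential-invariant e ss (WellFormed-unstep s wf))

-- From labelled bipartite trees to the theorem

LabelledBipartite⇒WellFormed : ∀ n m k t → n + m ≡ k * 2 → LabelledBipartite n m t → WellFormed k t
LabelledBipartite⇒WellFormed n m k t n+m≡2k (alt , perm) =
  record
    { alternating = alt
    ; distinct    = Permutationₛ.Unique-resp-↭ (setoid Label) (↭⇒↭ₛ (↭-sym perm)) labels-distinct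
    ; size        = labels-size
    }
  where
  whites = map (λ i → white (suc i)) (upTo n)
  blacks = map (λ i → black (suc i)) (upTo m)
  disjoint : Disjoint whites blacks
  disjoint (v∈whites , v∈blacks) with ∈-map⁻ _ v∈whites | ∈-map⁻ _ v∈blacks
  -- A common label would be built by both `white` and `black`.
  ... | _ , _ , refl | _ , _ , ()
  labels-distinct : Unique (whites ++ blacks)
  labels-distinct = Uniqueₚ.++⁺
    (Uniqueₚ.map⁺ (λ { refl → refl }) (Uniqueₚ.upTo⁺ n))
    (Uniqueₚ.map⁺ (λ { refl → refl }) (Uniqueₚ.upTo⁺ m))
    disjoint
  labels-size : length (labels t) ≡ k * 2
  labels-size = begin
    length (labels t)               ≡⟨ ↭-length perm ⟩
    length (whites ++ blacks)       ≡⟨ length-++ whites ⟩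
    length whites + length blacks   ≡⟨ cong₂ _+_ (trans (length-map _ (upTo n)) (length-upTo n))
                                                 (trans (length-map _ (upTo m)) (length-upTo m)) ⟩
    n + m                           ≡⟨ n+m≡2k ⟩
    k * 2                           ∎

-- At a white root the correction vanishes, and what remains is the parity of the sum that
-- `invariant` reduces modulo 2.
potential-white : ∀ e k t → WhiteRoot t →
  parity (inversionCount (code t) + (closeLabels t + e) / 2) ≡ potential e k t
potential-white e k t root-white = begin
  parity (inversionCount (code t) + (closeLabels t + e) / 2)
    ≡⟨ +-homo-+ (inversionCount (code t)) _ ⟩
  parity (inversionCount (code t)) ℙ.+ H
    ≡⟨ cong (ℙ._+ H) (trans (parity-inversionCount (code t)) (cong inversions (labelsOf-code t))) ⟩
  inversions (labels t) ℙ.+ H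
    ≡⟨ ℙₚ.+-identityʳ _ ⟨
  (inversions (labels t) ℙ.+ H) ℙ.+ 0ℙ
    ≡⟨ cong (λ b → (inversions (labels t) ℙ.+ H) ℙ.+ (if b then 0ℙ else parity k)) root-white ⟨
  potential e k t ∎
  where
  H = parity ((closeLabels t + e) / 2)

theorem3p2 : (n m : ℕ) (t t' : Tree) →
    2 ∣ (n + m) →
    LabelledBipartite n m t →
    SamePlaneTree t t' →
    WhiteRoot t → WhiteRoot t' →
    invariant n m t ≡ invariant n m t'
theorem3p2 n m t t' (divides k n+m≡2k) bipartite same root root' =
  -- These are the sums inside `invariant` before reduction; the quotient `k` of the divisibility
  -- hypothesis serves as the half size.
  parity⇒%2 (inversionCount (code t) + (closeLabels t + e) / 2)
            (inversionCount (code t') + (closeLabels t' + e) / 2) (begin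
    parity (inversionCount (code t) + (closeLabels t + e) / 2)
      ≡⟨ potential-white e k t root ⟩
    potential e k t
      ≡⟨ potential-invariant e same (LabelledBipartite⇒WellFormed n m k t n+m≡2k bipartite) ⟩
    potential e k t'
      ≡⟨ potential-white e k t' root' ⟨
    parity (inversionCount (code t') + (closeLabels t' + e) / 2) ∎)
  where
  e = absDiff n m / 2
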